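{- For every integer $k\ge 1$, there are only finitely many $k$-vertex-critical $(2P_2,claw+P_1)$-free graphs.
   Context: Graphs are finite and simple, and "finitely many" means up to isomorphism. A graph $G$ is $k$-vertex-critical if $\chi(G)=k$ and $\chi(G-v)<k$ for all $v\in V(G)$, where $\chi$ denotes the chromatic number. A graph is $(H_1,H_2)$-free if it contains no induced subgraph isomorphic to $H_1$ or $H_2$. $2P_2$ is the disjoint union of two edges. The $claw$ is $K_{1,3}$, and $claw+P_1$ is the disjoint union of a claw and an isolated vertex. -}

module Defs where

open import Data.Bool using (Bool; true; false; T; _∨_)
open import Data.Bool.Properties using (∨-comm)
open import Data.Fin using (Fin; toℕ; splitAt; punchIn)
open import Data.Fin.Properties using (punchIn-injective)
open import Data.List using (List)
open import Data.List.Relation.Unary.Any using (Any)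
open import Data.Nat using (ℕ; zero; suc; pred; _+_; _≤_; _<_; _≡ᵇ_)
open import Data.Product using (∃; ∃-syntax; Σ-syntax; _×_; _,_; proj₂)
open import Data.Sum using (_⊎_; inj₁; inj₂)
open import Function.Bundles using (_↣_; _↔_; mk↣; Injection; Inverse)
open import Relation.Binary.PropositionalEquality using (_≡_; _≢_; refl; cong₂)
open import Relation.Nullary using (¬_)

-- Finite simple graphs with vertex set Fin n.
record Graph (n : ℕ) : Set where
  field
    adj    : Fin n → Fin n → Bool
    sym    : ∀ u v → adj u v ≡ adj v u
    irrefl : ∀ v → adj v v ≡ false

  Adj : Fin n → Fin n → Set
  Adj u v = T (adj u v)

open Graph public using (adj; Adj)

infix 4 _≅_

_≅_ : ∀ {m n} → Graph m → Graph n → Set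
_≅_ {m} {n} G H =
  Σ[ f ∈ Fin m ↔ Fin n ] (∀ u v → adj G u v ≡ adj H (Inverse.to f u) (Inverse.to f v))

-- The subgraph of G induced by the image of an injection.
induced : ∀ {m n} → Graph n → Fin m ↣ Fin n → Graph m
induced G f = record
  { adj    = λ u v → adj G (to u) (to v)
  ; sym    = λ u v → Graph.sym G (to u) (to v)
  ; irrefl = λ v → Graph.irrefl G (to v)
  }
  where open Injection f using (to)

_ContainsInduced_ : ∀ {n h} → Graph n → Graph h → Set
_ContainsInduced_ {n} G H = ∃[ m ] Σ[ f ∈ Fin m ↣ Fin n ] (induced G f ≅ H)

⟨_,_⟩-Free : ∀ {h₁ h₂ n} → Graph h₁ → Graph h₂ → Graph n → Set
⟨ H₁ , H₂ ⟩-Free G = ¬ (G ContainsInduced H₁) × ¬ (G ContainsInduced H₂)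

-- G ─ v: punchIn v enumerates the vertices other than v.
infixl 6 _─_

_─_ : ∀ {n} → Graph n → Fin n → Graph (pred n)
_─_ {suc n} G v = induced G (mk↣ (λ {i} {j} → punchIn-injective v i j))

Colourable : ∀ {n} → Graph n → ℕ → Set
Colourable {n} G k = Σ[ c ∈ (Fin n → Fin k) ] (∀ u v → Adj G u v → c u ≢ c v)

-- χ G is given by its graph: χ[ G ]≡ k says that k is the least number of
-- colours in a proper colouring of G.
χ[_]≡_ : ∀ {n} → Graph n → ℕ → Set
χ[ G ]≡ k = Colourable G k × (∀ j → Colourable G j → k ≤ j)

χ[_]<_ : ∀ {n} → Graph n → ℕ → Set
χ[ G ]< k = ∃[ j ] (χ[ G ]≡ j × j < k)

VertexCritical : ∀ {n} → ℕ → Graph n → Set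
VertexCritical k G = χ[ G ]≡ k × (∀ v → χ[ G ─ v ]< k)

-- Finitely many up to isomorphism: the listed graphs represent every
-- isomorphism class satisfying Φ (the list may contain other graphs too).
FinitelyMany : (∀ {n} → Graph n → Set) → Set
FinitelyMany Φ =
  Σ[ Gs ∈ List (∃ Graph) ] (∀ {n} (G : Graph n) → Φ G → Any (λ H → G ≅ proj₂ H) Gs)

-- The path on n vertices.
P : ∀ n → Graph n
P n = record
  { adj    = λ u v → (suc (toℕ u) ≡ᵇ toℕ v) ∨ (suc (toℕ v) ≡ᵇ toℕ u)
  ; sym    = λ u v → ∨-comm (suc (toℕ u) ≡ᵇ toℕ v) (suc (toℕ v) ≡ᵇ toℕ u)
  ; irrefl = λ v → cong₂ _∨_ (1+n≡ᵇn (toℕ v)) (1+n≡ᵇn (toℕ v))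
  }
  where
  1+n≡ᵇn : ∀ n → (suc n ≡ᵇ n) ≡ false
  1+n≡ᵇn zero    = refl
  1+n≡ᵇn (suc n) = 1+n≡ᵇn n

-- The complete bipartite graph K_{m,n}.
K : ∀ m n → Graph (m + n)
K m n = record
  { adj    = λ u v → joined (splitAt m u) (splitAt m v)
  ; sym    = λ u v → joined-sym (splitAt m u) (splitAt m v)
  ; irrefl = λ v → joined-irrefl (splitAt m v)
  }
  where
  joined : Fin m ⊎ Fin n → Fin m ⊎ Fin n → Bool
  joined (inj₁ _) (inj₁ _) = false
  joined (inj₁ _) (inj₂ _) = true
  joined (inj₂ _) (inj₁ _) = true
  joined (inj₂ _) (inj₂ _) = false

  joined-sym : ∀ x y → joined x y ≡ joined y x
  joined-sym (inj₁ _) (inj₁ _) = refl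
  joined-sym (inj₁ _) (inj₂ _) = refl
  joined-sym (inj₂ _) (inj₁ _) = refl
  joined-sym (inj₂ _) (inj₂ _) = refl

  joined-irrefl : ∀ x → joined x x ≡ false
  joined-irrefl (inj₁ _) = refl
  joined-irrefl (inj₂ _) = refl

-- Disjoint union.
infixl 6 _⊕_

_⊕_ : ∀ {m n} → Graph m → Graph n → Graph (m + n)
_⊕_ {m} {n} G H = record
  { adj    = λ u v → joined (splitAt m u) (splitAt m v)
  ; sym    = λ u v → joined-sym (splitAt m u) (splitAt m v)
  ; irrefl = λ v → joined-irrefl (splitAt m v)
  }
  where
  joined : Fin m ⊎ Fin n → Fin m ⊎ Fin n → Bool
  joined (inj₁ u) (inj₁ v) = adj G u v
  joined (inj₁ _) (inj₂ _) = false
  joined (inj₂ _) (inj₁ _) = false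
  joined (inj₂ u) (inj₂ v) = adj H u v

  joined-sym : ∀ x y → joined x y ≡ joined y x
  joined-sym (inj₁ u) (inj₁ v) = Graph.sym G u v
  joined-sym (inj₁ _) (inj₂ _) = refl
  joined-sym (inj₂ _) (inj₁ _) = refl
  joined-sym (inj₂ u) (inj₂ v) = Graph.sym H u v

  joined-irrefl : ∀ x → joined x x ≡ false
  joined-irrefl (inj₁ v) = Graph.irrefl G v
  joined-irrefl (inj₂ v) = Graph.irrefl H v

2P₂ : Graph 4
2P₂ = P 2 ⊕ P 2

claw : Graph 4
claw = K 1 3

claw+P₁ : Graph 5
claw+P₁ = claw ⊕ P 1

{-# OPTIONS --safe #-}
-- Ramsey's theorem bounds the order of the graphs.  Let G be k-vertex-critical
-- and (2P₂ , claw+P₁)-free.  A clique of G has at most k vertices.  If s and t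
-- are distinct and nonadjacent then N(s) ⊈ N(t), for otherwise a colouring of
-- G ─ s extends to G by giving s the colour of t.  So fix an independent set
-- {t} ∪ S and choose w(s) ∈ N(s) ∖ N(t) for each s ∈ S.  As G is
-- claw+P₁-free, w(s) has at most one neighbour in S other than s; as G is
-- 2P₂-free, nonadjacency of w(s) and w(s′) forces one of them to be adjacent
-- to both s and s′.  Four pairwise nonadjacent w(s) would thus give six such
-- adjacencies, where only four are possible.  Hence if S is large then some
-- k + 1 of the w(s) form a clique, a contradiction.
module Submission where

open import Data.Bool using (Bool; true; false; T; _∧_; _∨_; not)
open import Data.Bool.Properties using (T?; T-≡; ¬-not; ∨-comm; ∨-idem; ∧-zeroʳ; ∧-identityʳ)
open import Data.Fin using (Fin; zero; suc; punchOut; finToFun; funToFin)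
  renaming (_<_ to _<ᶠ_)
open import Data.Fin.Properties
  using (_≟_; any?; pigeonhole; <-cmp; punchIn-punchOut; finToFun-funToFin; 2↔Bool)
open import Data.List using (List; []; _∷_; length; lookup; tabulate; allFin; filter; map; concatMap; upTo)
open import Data.List.Properties using (length-map; length-tabulate; tabulate-lookup)
open import Data.List.Membership.Propositional using (lose)
open import Data.List.Membership.Propositional.Properties using (∈-allFin; ∈-upTo⁺)
open import Data.List.Relation.Binary.Sublist.Propositional using (_⊆_; []; _∷_; _∷ʳ_; ⊆-trans; minimum)
open import Data.List.Relation.Binary.Sublist.Propositional.Properties using (All-resp-⊆; filter-⊆)
open import Data.List.Relation.Unary.All as All using (All; []; _∷_)
open import Data.List.Relation.Unary.All.Properties as All using (all-filter)
open import Data.List.Relation.Unary.AllPairs as AllPairs using (AllPairs; []; _∷_)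
import Data.List.Relation.Unary.AllPairs.Properties as AllPairs
open import Data.List.Relation.Unary.Any using (Any)
open import Data.List.Relation.Unary.Any.Properties using (concatMap⁺; map⁺)
open import Data.List.Relation.Unary.Unique.Propositional.Properties using (allFin⁺)
open import Data.Nat using (ℕ; zero; suc; _+_; _^_; _≤_; _<_; _≥_; s≤s; _≤?_)
open import Data.Nat.Properties
  using (≤-reflexive; +-suc; suc-injective; +-mono-<; ≰⇒>; <⇒≱)
open import Data.Product using (∃; ∃-syntax; Σ-syntax; _×_; _,_; proj₁; proj₂)
open import Data.Sum using (_⊎_; inj₁; inj₂; [_,_]′)
open import Data.Vec using ([]; _∷_) renaming (lookup to lookupᵛ)
open import Defs
open import Function using (_∘_; id; mk↣; Equivalence; Inverse)
open import Function.Construct.Identity using (↔-id)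
open import Level using (Level)
open import Relation.Binary.Core using (Rel)
open import Relation.Binary.Definitions using (tri<; tri≈; tri>) renaming (Decidable to Decidable₂)
open import Relation.Binary.PropositionalEquality
open import Relation.Nullary using (¬_; Dec; yes; no; does; contradiction; ¬?; _×-dec_)
open import Relation.Nullary.Decidable using (dec-true; dec-false; decidable-stable)
open import Relation.Unary using (Decidable)

private
  variable
    a ℓ : Level
    A : Set a
    m n k : ℕ

-- Pairwise relations on lists and Ramsey's theorem.

AllPairs-resp-⊆ : {R : Rel A ℓ} {xs ys : List A} → xs ⊆ ys → AllPairs R ys → AllPairs R xs
AllPairs-resp-⊆ []          []       = []
AllPairs-resp-⊆ (_ ∷ʳ p)    (_ ∷ rs) = AllPairs-resp-⊆ p rs
AllPairs-resp-⊆ (refl ∷ p)  (r ∷ rs) = All-resp-⊆ p r ∷ AllPairs-resp-⊆ p rs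

AllPairs-tabulate⁻ : {R : Rel A ℓ} {f : Fin n → A} → AllPairs R (tabulate f) →
                     ∀ {i j} → i <ᶠ j → R (f i) (f j)
AllPairs-tabulate⁻ (r ∷ _)  {zero}  {suc j} _         = All.tabulate⁻ r j
AllPairs-tabulate⁻ (_ ∷ rs) {suc i} {suc j} (s≤s i<j) = AllPairs-tabulate⁻ rs i<j

length-filter-+ : {P : A → Set ℓ} (P? : Decidable P) (xs : List A) →
                  length xs ≡ length (filter P? xs) + length (filter (¬? ∘ P?) xs)
length-filter-+ P? []       = refl
length-filter-+ P? (x ∷ xs) with does (P? x)
... | true  = cong suc (length-filter-+ P? xs)
... | false = trans (cong suc (length-filter-+ P? xs)) (sym (+-suc _ _))

-- An upper bound for Ramsey numbers: the entries after the head split into those that the head is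
-- related to and the rest, and one of the two parts must reach its own recursive bound.
ramseyBound : ℕ → ℕ → ℕ
ramseyBound zero    _       = 0
ramseyBound (suc p) zero    = 0
ramseyBound (suc p) (suc q) = suc (ramseyBound p (suc q) + ramseyBound (suc p) q)

-- R need not be symmetric: AllPairs only compares earlier with later entries.
ramsey : {R : Rel A ℓ} → Decidable₂ R → ∀ p q (xs : List A) → ramseyBound p q ≤ length xs →
         (∃[ ys ] ys ⊆ xs × length ys ≡ p × AllPairs R ys) ⊎
         (∃[ ys ] ys ⊆ xs × length ys ≡ q × AllPairs (λ x y → ¬ R x y) ys)
ramsey R? zero    q       xs       _ = inj₁ ([] , minimum xs , refl , [])
ramsey R? (suc p) zero    xs       _ = inj₂ ([] , minimum xs , refl , [])
ramsey {R = R} R? (suc p) (suc q) (x ∷ xs) (s≤s long) = split (ramseyBound p (suc q) ≤? length near)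
  where
  near = filter (R? x) xs
  far  = filter (¬? ∘ R? x) xs

  near⊆ : near ⊆ xs
  near⊆ = filter-⊆ (R? x) xs

  far⊆ : far ⊆ xs
  far⊆ = filter-⊆ (¬? ∘ R? x) xs

  Goal = (∃[ ys ] ys ⊆ x ∷ xs × length ys ≡ suc p × AllPairs R ys) ⊎
         (∃[ ys ] ys ⊆ x ∷ xs × length ys ≡ suc q × AllPairs (λ x y → ¬ R x y) ys)

  split : Dec (ramseyBound p (suc q) ≤ length near) → Goal
  split (yes nearLong) with ramsey R? p (suc q) near nearLong
  ... | inj₁ (ys , ys⊆ , len , rs) =
    inj₁ (x ∷ ys , refl ∷ ⊆-trans ys⊆ near⊆ , cong suc len , All-resp-⊆ ys⊆ (all-filter (R? x) xs) ∷ rs)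
  ... | inj₂ (ys , ys⊆ , len , rs) = inj₂ (ys , x ∷ʳ ⊆-trans ys⊆ near⊆ , len , rs)
  split (no nearShort) with ramseyBound (suc p) q ≤? length far
  ... | no farShort = contradiction long (<⇒≱
        (subst (_< ramseyBound p (suc q) + ramseyBound (suc p) q) (sym (length-filter-+ (R? x) xs))
          (+-mono-< (≰⇒> nearShort) (≰⇒> farShort))))
  ... | yes farLong with ramsey R? (suc p) q far farLong
  ...   | inj₁ (ys , ys⊆ , len , rs) = inj₁ (ys , x ∷ʳ ⊆-trans ys⊆ far⊆ , len , rs)
  ...   | inj₂ (ys , ys⊆ , len , rs) =
    inj₂ (x ∷ ys , refl ∷ ⊆-trans ys⊆ far⊆ , cong suc len ,
          All-resp-⊆ ys⊆ (all-filter (¬? ∘ R? x) xs) ∷ rs)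

-- Induced subgraphs, cliques and colourings.

embed : (G : Graph n) (H : Graph m) (f : Fin m → Fin n) →
        AllPairs (λ u v → f u ≢ f v × adj G (f u) (f v) ≡ adj H u v) (allFin m) →
        G ContainsInduced H
embed {m = m} G H f pairs = m , mk↣ (λ {u} {v} → injective u v) , ↔-id _ , preserves
  where
  injective : ∀ u v → f u ≡ f v → u ≡ v
  injective u v fu≡fv with <-cmp u v
  ... | tri< u<v _ _ = contradiction fu≡fv (proj₁ (AllPairs-tabulate⁻ pairs u<v))
  ... | tri≈ _ u≡v _ = u≡v
  ... | tri> _ _ v<u = contradiction (sym fu≡fv) (proj₁ (AllPairs-tabulate⁻ pairs v<u))

  -- The hypothesis covers only `u` before `v`; symmetry of adjacency gives the opposite order and
  -- irreflexivity the diagonal.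
  preserves : ∀ u v → adj G (f u) (f v) ≡ adj H u v
  preserves u v with <-cmp u v
  ... | tri< u<v _ _  = proj₂ (AllPairs-tabulate⁻ pairs u<v)
  ... | tri≈ _ refl _ = trans (Graph.irrefl G (f u)) (sym (Graph.irrefl H u))
  ... | tri> _ _ v<u  = trans (Graph.sym G (f u) (f v))
                          (trans (proj₂ (AllPairs-tabulate⁻ pairs v<u)) (Graph.sym H v u))

Colourable-length-clique : (G : Graph n) → Colourable G k → ∀ {xs} → AllPairs (Adj G) xs → length xs ≤ k
Colourable-length-clique {k = k} G (c , proper) {xs} clique with length xs ≤? k
... | yes short = short
... | no  long  =
  let i , j , i<j , same = pigeonhole (≰⇒> long) (c ∘ lookup xs)
  in contradiction same (proper _ _
       (AllPairs-tabulate⁻ (subst (AllPairs (Adj G)) (sym (tabulate-lookup xs)) clique) i<j))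

-- A homomorphism of `G` into itself that misses `s` is one into `G ─ s`, and colourings pull back
-- along homomorphisms.
Colourable-retract : (G : Graph n) (s : Fin n) (h : Fin n → Fin n) →
                     (∀ v → s ≢ h v) → (∀ u v → Adj G u v → Adj G (h u) (h v)) →
                     Colourable (G ─ s) k → Colourable G k
Colourable-retract {suc n} G s h avoids hom (c , proper) =
  (λ v → c (punchOut (avoids v))) ,
  λ u v uv → proper _ _ (subst₂ (Adj G) (sym (punchIn-punchOut (avoids u)))
                           (sym (punchIn-punchOut (avoids v))) (hom u v uv))

-- Neighbourhoods in a vertex-critical graph.

module _ (G : Graph n) where

  Adj? : Decidable₂ (Adj G)
  Adj? u v = T? (adj G u v)

  Adj-sym : ∀ {u v} → Adj G u v → Adj G v u
  Adj-sym {u} {v} = subst T (Graph.sym G u v)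

  Adj-irrefl : ∀ {v} → ¬ Adj G v v
  Adj-irrefl {v} = subst T (Graph.irrefl G v)

  Adj⇒≢ : ∀ {u v} → Adj G u v → u ≢ v
  Adj⇒≢ uv refl = Adj-irrefl uv

  Indep : Rel (Fin n) _
  Indep u v = u ≢ v × ¬ Adj G u v

  Indep-sym : ∀ {u v} → Indep u v → Indep v u
  Indep-sym (u≢v , u≁v) = u≢v ∘ sym , u≁v ∘ Adj-sym

  N⊈N : VertexCritical k G → ∀ {s t} → Indep s t → ∃[ v ] Adj G s v × ¬ Adj G v t
  N⊈N ((_ , least) , critical) {s} {t} (s≢t , s≁t)
    with any? (λ v → Adj? s v ×-dec ¬? (Adj? v t))
  ... | yes v = v
  ... | no none = let _ , (colouring , _) , j<k = critical s in
                  contradiction (least _ (Colourable-retract G s fold avoids hom colouring)) (<⇒≱ j<k)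
    where
    N⊆N : ∀ {v} → Adj G s v → Adj G v t
    N⊆N {v} sv = decidable-stable (Adj? v t) (λ v≁t → none (v , sv , v≁t))

    -- Only `s` is moved, onto `t`; the inclusion `N⊆N` is what makes this a homomorphism.
    fold : Fin n → Fin n
    fold v with s ≟ v
    ... | yes _ = t
    ... | no  _ = v

    avoids : ∀ v → s ≢ fold v
    avoids v with s ≟ v
    ... | yes _  = s≢t
    ... | no s≢v = s≢v

    hom : ∀ u v → Adj G u v → Adj G (fold u) (fold v)
    hom u v uv with s ≟ u | s ≟ v
    ... | yes refl | yes refl = contradiction uv Adj-irrefl
    ... | yes refl | no _     = Adj-sym (N⊆N uv)
    ... | no _     | yes refl = N⊆N (Adj-sym uv)
    ... | no _     | no _     = uv

  private
    edge : ∀ {u v} → Adj G u v → u ≢ v × adj G u v ≡ true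
    edge uv = Adj⇒≢ uv , Equivalence.to T-≡ uv

    nonedge : ∀ {u v} → Indep u v → u ≢ v × adj G u v ≡ false
    nonedge (u≢v , u≁v) = u≢v , ¬-not (u≁v ∘ Equivalence.from T-≡)

  2P₂-embed : ∀ {a b c d} → Adj G a b → Adj G c d →
              Indep a c → Indep a d → Indep b c → Indep b d → G ContainsInduced 2P₂
  2P₂-embed {a} {b} {c} {d} ab cd ac ad bc bd = embed G 2P₂ (lookupᵛ (a ∷ b ∷ c ∷ d ∷ []))
    ( (edge ab ∷ nonedge ac ∷ nonedge ad ∷ [])
    ∷ (nonedge bc ∷ nonedge bd ∷ [])
    ∷ (edge cd ∷ [])
    ∷ [] ∷ [])

  claw+P₁-embed : ∀ {a x y z t} → Adj G a x → Adj G a y → Adj G a z →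
                  Indep x y → Indep x z → Indep y z →
                  Indep a t → Indep x t → Indep y t → Indep z t → G ContainsInduced claw+P₁
  claw+P₁-embed {a} {x} {y} {z} {t} ax ay az xy xz yz at xt yt zt =
    embed G claw+P₁ (lookupᵛ (a ∷ x ∷ y ∷ z ∷ t ∷ []))
      ( (edge ax ∷ edge ay ∷ edge az ∷ nonedge at ∷ [])
      ∷ (nonedge xy ∷ nonedge xz ∷ nonedge xt ∷ [])
      ∷ (nonedge yz ∷ nonedge yt ∷ [])
      ∷ (nonedge zt ∷ [])
      ∷ [] ∷ [])

  -- Private neighbours against the forbidden subgraphs.

  module _ (2P₂-free : ¬ (G ContainsInduced 2P₂)) (claw+P₁-free : ¬ (G ContainsInduced claw+P₁))
           (t : Fin n) (w : Fin n → Fin n)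
           (w-private : ∀ {s} → Indep s t → Adj G s (w s) × ¬ Adj G (w s) t) where

    -- `w` may take the same value at `x` and `y`, since `ramsey` only yields nonadjacency of `w x`
    -- and `w y`.
    Far : Rel (Fin n) _
    Far x y = Indep x y × ¬ Adj G (w x) (w y)

    Far-sym : ∀ {x y} → Far x y → Far y x
    Far-sym (xy , wx≁wy) = Indep-sym xy , wx≁wy ∘ Adj-sym

    -- Otherwise the edges from `x` to `w x` and from `y` to `w y` induce `2P₂`: a coincidence of
    -- `w x` or `w y` with an end of the other edge would create an excluded adjacency.
    cross : ∀ {x y} → Indep x t → Indep y t → Far x y → Adj G (w x) y ⊎ Adj G (w y) x
    cross {x} {y} xt yt ((x≢y , x≁y) , wx≁wy) with Adj? (w x) y | Adj? (w y) x
    ... | yes wx~y | _        = inj₁ wx~y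
    ... | no _     | yes wy~x = inj₂ wy~x
    ... | no wx≁y  | no wy≁x  = contradiction
      (2P₂-embed x~wx y~wy (x≢y , x≁y)
        ((λ { refl → x≁y (Adj-sym y~wy) }) , wy≁x ∘ Adj-sym)
        ((λ { refl → x≁y x~wx }) , wx≁y)
        ((λ wx≡wy → wy≁x (subst (λ v → Adj G v x) wx≡wy (Adj-sym x~wx))) , wx≁wy))
      2P₂-free
      where
      x~wx = proj₁ (w-private xt)
      y~wy = proj₁ (w-private yt)

    -- Otherwise `w x` is the centre of a claw with leaves `x`, `y`, `z`, and `t` is the isolated
    -- vertex; `w x` differs from `t` because `x` is adjacent to `w x` but not to `t`.
    cross-unique : ∀ {x y z} → Indep x t → Indep y t → Indep z t →
                   Indep x y → Indep x z → Indep y z → Adj G (w x) y → ¬ Adj G (w x) z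
    cross-unique xt yt zt xy xz yz wx~y wx~z = claw+P₁-free
      (claw+P₁-embed (Adj-sym x~wx) wx~y wx~z xy xz yz
        ((λ { refl → proj₂ xt x~wx }) , wx≁t) xt yt zt)
      where
      x~wx = proj₁ (w-private xt)
      wx≁t = proj₂ (w-private xt)

    -- The count of adjacencies as a case analysis: `y` uses up the one further neighbour of `w x`,
    -- so `cross` makes `w z` and `w u` adjacent to `x`. These are then used up too, and nothing is
    -- left for the pair `z`, `u`.
    cross-absurd : ∀ {x y z u} → Indep x t → Indep y t → Indep z t → Indep u t →
                   Far x y → Far x z → Far x u → Far y z → Far y u → Far z u → ¬ Adj G (w x) y
    cross-absurd {x} {y} {z} {u} xt yt zt ut xy xz xu yz yu zu wx~y =
      [ cross-unique zt xt ut (Indep-sym (proj₁ xz)) (proj₁ zu) (proj₁ xu) (into zt xz yz)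
      , cross-unique ut xt zt (Indep-sym (proj₁ xu)) (Indep-sym (proj₁ zu)) (proj₁ xz) (into ut xu yu)
      ]′ (cross zt ut zu)
      where
      into : ∀ {v} → Indep v t → Far x v → Far y v → Adj G (w v) x
      into vt xv yv with cross xt vt xv
      ... | inj₁ wx~v = contradiction wx~v (cross-unique xt yt vt (proj₁ xy) (proj₁ xv) (proj₁ yv) wx~y)
      ... | inj₂ wv~x = wv~x

    four-absurd : ∀ {xs} → length xs ≡ 4 → All (λ s → Indep s t) xs → ¬ AllPairs Far xs
    four-absurd {_ ∷ _ ∷ _ ∷ _ ∷ []} _ (xt ∷ yt ∷ zt ∷ ut ∷ [])
      ((xy ∷ xz ∷ xu ∷ []) ∷ (yz ∷ yu ∷ []) ∷ (zu ∷ []) ∷ [] ∷ []) =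
      [ cross-absurd xt yt zt ut xy xz xu yz yu zu
      , cross-absurd yt xt zt ut (Far-sym xy) yz yu xz xu zu
      ]′ (cross xt yt xy)

  -- Bounding the order.

  private-neighbours : VertexCritical k G → ∀ t → Σ[ w ∈ (Fin n → Fin n) ]
                       (∀ {s} → Indep s t → Adj G s (w s) × ¬ Adj G (w s) t)
  private-neighbours critical t = (λ s → proj₁ (choose s)) , λ {s} → proj₂ (choose s)
    where
    choose : ∀ s → ∃[ v ] (Indep s t → Adj G s v × ¬ Adj G v t)
    choose s with any? (λ v → Adj? s v ×-dec ¬? (Adj? v t))
    ... | yes (v , v-private) = v , λ _ → v-private
    -- The value `s` is a default: by `N⊈N` this case arises only if `s` and `t` are not
    -- independent, so the claim about it is vacuous.
    ... | no none = s , λ st → contradiction (N⊈N critical st) none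

  -- `ramsey` is applied twice. On the vertices of `G` it gives an independent list, whose head
  -- serves as `t` and accounts for the inner successor in the bound. On the tail, comparing values
  -- of `w`, it gives a clique of size `suc k` or four pairwise `Far` vertices.
  order-bound : VertexCritical k G → ⟨ 2P₂ , claw+P₁ ⟩-Free G →
                n < ramseyBound (suc k) (suc (ramseyBound (suc k) 4))
  order-bound {k} critical@((colouring , _) , _) (2P₂-free , claw+P₁-free) = ≰⇒> large-absurd
    where
    no-clique : ∀ {xs} → length xs ≡ suc k → ¬ AllPairs (Adj G) xs
    no-clique len clique = <⇒≱ (≤-reflexive (sym len)) (Colourable-length-clique G colouring clique)

    independent-absurd : ∀ {t xs} → All (Indep t) xs → AllPairs Indep xs → length xs ≢ ramseyBound (suc k) 4
    independent-absurd {t} {xs} txs indep len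
      with w , w-private ← private-neighbours critical t
      with ramsey (λ x y → Adj? (w x) (w y)) (suc k) 4 xs (≤-reflexive (sym len))
    ... | inj₁ (ys , _ , ylen , clique) =
      no-clique (trans (length-map w ys) ylen) (AllPairs.map⁺ clique)
    ... | inj₂ (ys , ys⊆ , ylen , far) =
      four-absurd 2P₂-free claw+P₁-free t w w-private ylen
        (All.map Indep-sym (All-resp-⊆ ys⊆ txs)) (AllPairs.zip (AllPairs-resp-⊆ ys⊆ indep , far))

    large-absurd : ¬ (ramseyBound (suc k) (suc (ramseyBound (suc k) 4)) ≤ n)
    large-absurd large
      with ramsey Adj? (suc k) (suc (ramseyBound (suc k) 4)) (allFin n)
             (subst (_ ≤_) (sym (length-tabulate id)) large)
    ... | inj₁ (_ , _ , len , clique) = no-clique len clique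
    ... | inj₂ (t ∷ xs , xs⊆ , len , nonadj)
      with txs ∷ indep ← AllPairs.zip (AllPairs-resp-⊆ xs⊆ (allFin⁺ n) , nonadj) =
      independent-absurd txs indep (suc-injective len)

-- Enumeration of the graphs of a given order.

symmetrise : (Fin n → Fin n → Bool) → Graph n
symmetrise g = record
  { adj    = λ u v → (g u v ∨ g v u) ∧ not (does (u ≟ v))
  ; sym    = λ u v → cong₂ _∧_ (∨-comm (g u v) (g v u)) (cong not (does-≟-sym u v))
  ; irrefl = λ v → trans (cong (λ b → (g v v ∨ g v v) ∧ not b) (dec-true (v ≟ v) refl)) (∧-zeroʳ _)
  }
  where
  does-≟-sym : ∀ u v → does (u ≟ v) ≡ does (v ≟ u)
  does-≟-sym u v with u ≟ v
  ... | yes refl = sym (dec-true (v ≟ u) refl)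
  ... | no u≢v   = sym (dec-false (v ≟ u) (u≢v ∘ sym))

symmetrise-≅ : (G : Graph n) {g : Fin n → Fin n → Bool} → (∀ u v → g u v ≡ adj G u v) → G ≅ symmetrise g
symmetrise-≅ G {g} g≗ = ↔-id _ , agrees
  where
  agrees : ∀ u v → adj G u v ≡ adj (symmetrise g) u v
  agrees u v rewrite g≗ u v | g≗ v u | Graph.sym G v u | ∨-idem (adj G u v) with u ≟ v
  ... | yes refl = trans (Graph.irrefl G u) (sym (∧-zeroʳ _))
  ... | no _     = sym (∧-identityʳ _)

-- Each number below `(2 ^ n) ^ n` encodes an `n` by `n` Boolean matrix. As `symmetrise` makes a
-- graph of any matrix, no code has to be rejected, and repetitions do no harm.
graphsOfOrder : ∀ n → List (∃ Graph)
graphsOfOrder n = map (λ c → n , symmetrise (decode c)) (allFin ((2 ^ n) ^ n))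
  where
  decode : Fin ((2 ^ n) ^ n) → Fin n → Fin n → Bool
  decode c u v = Inverse.to 2↔Bool (finToFun (finToFun c u) v)

graphsOfOrder-complete : (G : Graph n) → Any (λ H → G ≅ proj₂ H) (graphsOfOrder n)
graphsOfOrder-complete {n} G = map⁺ (lose (∈-allFin (funToFin rows)) (symmetrise-≅ G decode-encode))
  where
  bits : Fin n → Fin n → Fin 2
  bits u v = Inverse.from 2↔Bool (adj G u v)

  rows : Fin n → Fin (2 ^ n)
  rows u = funToFin (bits u)

  decode-encode : ∀ u v → Inverse.to 2↔Bool (finToFun (finToFun (funToFin rows) u) v) ≡ adj G u v
  decode-encode u v
    rewrite finToFun-funToFin rows u | finToFun-funToFin (bits u) v = Inverse.inverseˡ 2↔Bool refl

FinitelyMany-bounded : (Φ : ∀ {n} → Graph n → Set) (N : ℕ) →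
                       (∀ {n} (G : Graph n) → Φ G → n < N) → FinitelyMany Φ
FinitelyMany-bounded Φ N bounded =
  concatMap graphsOfOrder (upTo N) ,
  λ G φ → concatMap⁺ graphsOfOrder (lose (∈-upTo⁺ (bounded G φ)) (graphsOfOrder-complete G))

corollary4p4 : (k : ℕ) → k ≥ 1 → FinitelyMany (λ G → VertexCritical k G × ⟨ 2P₂ , claw+P₁ ⟩-Free G)
corollary4p4 k _ = FinitelyMany-bounded (λ G → VertexCritical k G × ⟨ 2P₂ , claw+P₁ ⟩-Free G) _
  λ G (critical , free) → order-bound G critical free
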